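{- There is a computable perfect tree $T$ such that every path through $T$ has asymptotic density $1/2$, and the symmetric difference of any two distinct paths through $T$ also has asymptotic density $1/2$.
   Context: A perfect tree is a map $T:2^{<\omega}\to 2^{<\omega}$ such that for each $\sigma$, the strings $T(\sigma^\frown0)$ and $T(\sigma^\frown1)$ are incompatible and both properly extend $T(\sigma)$; its paths are the sets $T(X)=\bigcup_{\sigma\prec X}T(\sigma)$ for $X\in2^\omega$. The asymptotic density of $A\subseteq\omega$ is $\lim_n |A\cap[0,n)|/n$ when this limit exists. -}

module Defs where

open import Data.Bool using (Bool; true; false; _xor_)
open import Data.Nat using (ℕ; zero; suc; _≤_; _<_)
open import Data.List using (List; []; _∷_; _++_; [_]; length; map; upTo)
open import Data.List.Relation.Binary.Prefix.Heterogeneous using (Prefix)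
open import Data.Integer using (+_)
open import Data.Rational using (ℚ; _/_; ½; ∣_∣; _-_; Positive)
import Data.Rational as ℚ
open import Data.Product using (Σ; _×_; ∃)
open import Relation.Binary.PropositionalEquality using (_≡_; _≢_)
open import Relation.Nullary using (¬_)

Str : Set
Str = List Bool

_≼_ : Str → Str → Set
σ ≼ τ = Prefix _≡_ σ τ

_≺_ : Str → Str → Set
σ ≺ τ = σ ≼ τ × length σ < length τ

Incompatible : Str → Str → Set
Incompatible σ τ = ¬ (σ ≼ τ) × ¬ (τ ≼ σ)

IsPerfectTree : (Str → Str) → Set
IsPerfectTree T = ∀ σ →
  Incompatible (T (σ ++ [ false ])) (T (σ ++ [ true ]))
  × T σ ≺ T (σ ++ [ false ])
  × T σ ≺ T (σ ++ [ true ])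

-- elements of 2^ω / characteristic functions of subsets of ω
Seq : Set
Seq = ℕ → Bool

_↾_ : Seq → ℕ → Str
X ↾ n = map X (upTo n)

-- k-th entry of a string (false if out of range)
at : Str → ℕ → Bool
at []      _       = false
at (b ∷ _) zero    = b
at (_ ∷ σ) (suc k) = at σ k

-- the path T(X) = ⋃_{σ ≺ X} T(σ).  For a perfect tree |T(X↾(k+1))| ≥ k+1,
-- so the k-th bit of T(X) is the k-th bit of T(X↾(k+1)).
path : (Str → Str) → Seq → Seq
path T X k = at (T (X ↾ suc k)) k

count : Seq → ℕ → ℕ
count A zero = 0
count A (suc n) with A n
... | true  = suc (count A n)
... | false = count A n

_△_ : Seq → Seq → Seq
(A △ B) k = A k xor B k

HasDensity : Seq → ℚ → Set
HasDensity A q = ∀ (ε : ℚ) → Positive ε → ∃ λ N → ∀ n → N ≤ n →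
  ∣ (+ count A (suc n)) / suc n - q ∣ ℚ.< ε

-- X and Y are distinct (constructive apartness: they differ somewhere)
Distinct : Seq → Seq → Set
Distinct X Y = ∃ λ k → X k ≢ Y k

-- T(σ) is grown from the seed 01 by reading σ bit by bit, each time appending to the
-- current string a copy of itself (bit 0) or its complement (bit 1).  Every stage is
-- balanced, and appending a balanced string, or the complement of one, to a balanced
-- string keeps the discrepancy 2·|A ∩ [0,m)| − m of all prefixes bounded by the same
-- constant; so along every path the discrepancy stays below the length of the seed,
-- which forces density 1/2.  Writing the appended string as map (b xor_) s, the
-- pointwise xor of the stages along σ and τ is the stage grown from 00 along σ ⊕ τ.
-- At the first position where σ and τ differ this string is extended by its own
-- complement, hence becomes balanced, and from then on the same bound applies with
-- the length of that stage in place of the length of the seed.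

module Submission where

open import Defs
open import Data.Product using (Σ; _×_)
open import Data.Rational using (½)

open import Algebra.Bundles using (CommutativeRing)
open import Data.Bool using (Bool; true; false; not; _xor_)
open import Data.Bool.Properties using (not-¬; xor-∧-commutativeRing)
open import Data.Integer as ℤ using (ℤ; +_; +[1+_]; 0ℤ; 1ℤ; -1ℤ)
import Data.Integer.Properties as ℤ
open import Data.Integer.Tactic.RingSolver using (solve-∀)
open import Data.List using ([]; _∷_; _++_; [_]; _∷ʳ_; length; map; foldl; zipWith; applyUpTo; upTo)
import Data.List.Properties as List
import Data.List.Relation.Binary.Pointwise as Pointwise
open import Data.List.Relation.Binary.Prefix.Heterogeneous using ([]; _∷_)
open import Data.List.Relation.Binary.Prefix.Heterogeneous.Properties using (++⁻)
import Data.List.Relation.Binary.Prefix.Heterogeneous.Properties as Prefix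
open import Data.Nat as ℕ using (ℕ; zero; suc; _+_; _≤_; _<_; z≤n; s≤s; _≤?_)
import Data.Nat.Properties as ℕ
open import Data.Product using (_,_)
open import Data.Rational as ℚ using (mkℚ; toℚᵘ)
import Data.Rational.Properties as ℚ
open import Data.Rational.Unnormalised as ℚᵘ using (mkℚᵘ; *<*)
import Data.Rational.Unnormalised.Properties as ℚᵘ
open import Function using (_∘_)
open import Relation.Nullary using (yes; no)
open import Data.Empty using (⊥-elim)
open import Relation.Binary.PropositionalEquality hiding ([_])

import Algebra.Properties.CommutativeSemigroup as CommutativeSemigroupProperties

module ℤ+ = CommutativeSemigroupProperties ℤ.+-commutativeSemigroup
module Xor = CommutativeSemigroupProperties
  (CommutativeRing.+-commutativeSemigroup xor-∧-commutativeRing)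

-- Density from bounded discrepancy

-- Opaque, so that unification never unfolds it into count arithmetic.
opaque
  discrepancy : Seq → ℕ → ℤ
  discrepancy f m = + 2 ℤ.* + count f m ℤ.- + m

sign : Bool → ℤ
sign true  = 1ℤ
sign false = -1ℤ

opaque
  unfolding discrepancy

  discrepancy-zero : ∀ f → discrepancy f 0 ≡ 0ℤ
  discrepancy-zero f = refl

  discrepancy-suc : ∀ f m → discrepancy f (suc m) ≡ sign (f m) ℤ.+ discrepancy f m
  discrepancy-suc f m with f m
  ... | true  = trans (cong₂ (λ c k → + 2 ℤ.* c ℤ.- k) (ℤ.pos-+ 1 (count f m)) (ℤ.pos-+ 1 m))
                      (shift 1ℤ (+ count f m) (+ m))
    where
    shift : ∀ a c k → + 2 ℤ.* (a ℤ.+ c) ℤ.- (a ℤ.+ k) ≡ a ℤ.+ (+ 2 ℤ.* c ℤ.- k)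
    shift = solve-∀
  ... | false = trans (cong (λ k → + 2 ℤ.* + count f m ℤ.- k) (ℤ.pos-+ 1 m)) (shift (+ count f m) (+ m))
    where
    shift : ∀ c k → + 2 ℤ.* c ℤ.- (1ℤ ℤ.+ k) ≡ -1ℤ ℤ.+ (+ 2 ℤ.* c ℤ.- k)
    shift = solve-∀

discrepancy-cong : ∀ {f g} m → (∀ {k} → k < m → f k ≡ g k) → discrepancy f m ≡ discrepancy g m
discrepancy-cong {f} {g} zero _ = trans (discrepancy-zero f) (sym (discrepancy-zero g))
discrepancy-cong {f} {g} (suc m) f≡g = begin
  discrepancy f (suc m)            ≡⟨ discrepancy-suc f m ⟩
  sign (f m) ℤ.+ discrepancy f m   ≡⟨ cong₂ ℤ._+_ (cong sign (f≡g (ℕ.n<1+n m)))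
                                               (discrepancy-cong m (f≡g ∘ ℕ.m<n⇒m<1+n)) ⟩
  sign (g m) ℤ.+ discrepancy g m   ≡⟨ discrepancy-suc g m ⟨
  discrepancy g (suc m)            ∎
  where open ≡-Reasoning

∣discrepancy∣≤ : ∀ f m → ℤ.∣ discrepancy f m ∣ ≤ m
∣discrepancy∣≤ f zero    = ℕ.≤-reflexive (cong ℤ.∣_∣ (discrepancy-zero f))
∣discrepancy∣≤ f (suc m) = begin
  ℤ.∣ discrepancy f (suc m) ∣                  ≡⟨ cong ℤ.∣_∣ (discrepancy-suc f m) ⟩
  ℤ.∣ sign (f m) ℤ.+ discrepancy f m ∣         ≤⟨ ℤ.∣i+j∣≤∣i∣+∣j∣ (sign (f m)) (discrepancy f m) ⟩
  ℤ.∣ sign (f m) ∣ + ℤ.∣ discrepancy f m ∣     ≡⟨ cong (_+ ℤ.∣ discrepancy f m ∣) (∣sign∣≡1 (f m)) ⟩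
  suc ℤ.∣ discrepancy f m ∣                     ≤⟨ s≤s (∣discrepancy∣≤ f m) ⟩
  suc m                                          ∎
  where
  open ℕ.≤-Reasoning
  ∣sign∣≡1 : ∀ b → ℤ.∣ sign b ∣ ≡ 1
  ∣sign∣≡1 true  = refl
  ∣sign∣≡1 false = refl

opaque
  unfolding discrepancy

  ∣frequency-½∣≃ : ∀ f n → toℚᵘ ℚ.∣ + count f (suc n) ℚ./ suc n ℚ.- ½ ∣
                        ℚᵘ.≃ mkℚᵘ (+ ℤ.∣ discrepancy f (suc n) ∣) (suc n ℕ.* 2 ℕ.∸ 1)
  ∣frequency-½∣≃ f n = begin
    toℚᵘ ℚ.∣ c ℚ./ suc n ℚ.- ½ ∣
      ≈⟨ ℚ.toℚᵘ-homo-∣-∣ (c ℚ./ suc n ℚ.- ½) ⟩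
    ℚᵘ.∣ toℚᵘ (c ℚ./ suc n ℚ.- ½) ∣
      ≈⟨ ℚᵘ.∣-∣-cong (ℚ.toℚᵘ-homo-+ (c ℚ./ suc n) (ℚ.- ½)) ⟩
    ℚᵘ.∣ toℚᵘ (c ℚ./ suc n) ℚᵘ.+ toℚᵘ (ℚ.- ½) ∣
      ≈⟨ ℚᵘ.∣-∣-cong (ℚᵘ.+-cong (ℚ.toℚᵘ-fromℚᵘ (mkℚᵘ c n)) (ℚ.toℚᵘ-homo‿- ½)) ⟩
    ℚᵘ.∣ mkℚᵘ c n ℚᵘ.- mkℚᵘ (+ 1) 1 ∣
      ≡⟨ cong (λ i → mkℚᵘ (+ ℤ.∣ i ∣) _) (numerator c (+ suc n)) ⟩
    mkℚᵘ (+ ℤ.∣ discrepancy f (suc n) ∣) (suc n ℕ.* 2 ℕ.∸ 1) ∎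
    where
    open ℚᵘ.≃-Reasoning
    c : ℤ
    c = + count f (suc n)
    numerator : ∀ i k → i ℤ.* + 2 ℤ.+ -1ℤ ℤ.* k ≡ + 2 ℤ.* i ℤ.- k
    numerator = solve-∀

bounded-discrepancy⇒density½ : ∀ f L → (∀ m → ℤ.∣ discrepancy f m ∣ ≤ L) → HasDensity f ½
bounded-discrepancy⇒density½ f L bounded (mkℚ +[1+ p ] q _) _ = L ℕ.* suc q , close
  where
  close : ∀ n → L ℕ.* suc q ≤ n → ℚ.∣ + count f (suc n) ℚ./ suc n ℚ.- ½ ∣ ℚ.< mkℚ +[1+ p ] q _
  close n Lq≤n = ℚ.toℚᵘ-cancel-< (ℚᵘ.<-respˡ-≃ (ℚᵘ.≃-sym (∣frequency-½∣≃ f n))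
    (*<* (subst₂ ℤ._<_ (ℤ.pos-* D (suc q)) (ℤ.pos-* (suc p) (suc n ℕ.* 2)) (ℤ.+<+ cross))))
    where
    D = ℤ.∣ discrepancy f (suc n) ∣
    open ℕ.≤-Reasoning
    cross : D ℕ.* suc q < suc p ℕ.* (suc n ℕ.* 2)
    cross = begin-strict
      D ℕ.* suc q             ≤⟨ ℕ.*-monoˡ-≤ (suc q) (bounded (suc n)) ⟩
      L ℕ.* suc q             ≤⟨ Lq≤n ⟩
      n                       <⟨ ℕ.n<1+n n ⟩
      suc n                   ≤⟨ ℕ.m≤m*n (suc n) 2 ⟩
      suc n ℕ.* 2             ≤⟨ ℕ.m≤n*m (suc n ℕ.* 2) (suc p) ⟩
      suc p ℕ.* (suc n ℕ.* 2) ∎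

-- Discrepancy of strings

≼-++ : ∀ s u → s ≼ (s ++ u)
≼-++ []      u = []
≼-++ (_ ∷ s) u = refl ∷ ≼-++ s u

incompatible-++ : ∀ s {u v} → Incompatible u v → Incompatible (s ++ u) (s ++ v)
incompatible-++ s (u⋠v , v⋠u) = u⋠v ∘ ++⁻ refl , v⋠u ∘ ++⁻ refl

≺-++ : ∀ s {u} → 0 < length u → s ≺ (s ++ u)
≺-++ s {u} 0<u = ≼-++ s u , subst (length s <_) (sym (List.length-++ s)) (ℕ.m<m+n (length s) 0<u)

at-≼ : ∀ {s t} → s ≼ t → ∀ {k} → k < length s → at t k ≡ at s k
at-≼ (refl ∷ _) {zero}  _          = refl
at-≼ (refl ∷ p) {suc k} (s≤s k<s) = at-≼ p k<s

at-++ʳ : ∀ a b j → at (a ++ b) (length a + j) ≡ at b j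
at-++ʳ []      b j = refl
at-++ʳ (_ ∷ a) b j = at-++ʳ a b j

at-map-not : ∀ s {k} → k < length s → at (map not s) k ≡ not (at s k)
at-map-not (_ ∷ _) {zero}  _          = refl
at-map-not (_ ∷ s) {suc k} (s≤s k<s) = at-map-not s k<s

discrepancy-++ˡ : ∀ a b {m} → m ≤ length a → discrepancy (at (a ++ b)) m ≡ discrepancy (at a) m
discrepancy-++ˡ a b m≤a = discrepancy-cong _ (λ k<m → at-≼ (≼-++ a b) (ℕ.<-≤-trans k<m m≤a))

discrepancy-++ : ∀ a b j →
  discrepancy (at (a ++ b)) (length a + j) ≡ discrepancy (at a) (length a) ℤ.+ discrepancy (at b) j
discrepancy-++ a b zero = begin
  discrepancy (at (a ++ b)) (length a + 0)
    ≡⟨ cong (discrepancy (at (a ++ b))) (ℕ.+-identityʳ (length a)) ⟩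
  discrepancy (at (a ++ b)) (length a)
    ≡⟨ discrepancy-++ˡ a b {length a} ℕ.≤-refl ⟩
  discrepancy (at a) (length a)
    ≡⟨ ℤ.+-identityʳ (discrepancy (at a) (length a)) ⟨
  discrepancy (at a) (length a) ℤ.+ 0ℤ
    ≡⟨ cong (ℤ._+_ (discrepancy (at a) (length a))) (discrepancy-zero (at b)) ⟨
  discrepancy (at a) (length a) ℤ.+ discrepancy (at b) 0 ∎
  where open ≡-Reasoning
discrepancy-++ a b (suc j) = begin
  discrepancy (at (a ++ b)) (length a + suc j)
    ≡⟨ cong (discrepancy (at (a ++ b))) (ℕ.+-suc (length a) j) ⟩
  discrepancy (at (a ++ b)) (suc (length a + j))
    ≡⟨ discrepancy-suc (at (a ++ b)) (length a + j) ⟩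
  sign (at (a ++ b) (length a + j)) ℤ.+ discrepancy (at (a ++ b)) (length a + j)
    ≡⟨ cong₂ ℤ._+_ (cong sign (at-++ʳ a b j)) (discrepancy-++ a b j) ⟩
  sign (at b j) ℤ.+ (discrepancy (at a) (length a) ℤ.+ discrepancy (at b) j)
    ≡⟨ ℤ+.x∙yz≈y∙xz (sign (at b j)) (discrepancy (at a) (length a)) (discrepancy (at b) j) ⟩
  discrepancy (at a) (length a) ℤ.+ (sign (at b j) ℤ.+ discrepancy (at b) j)
    ≡⟨ cong (ℤ._+_ (discrepancy (at a) (length a))) (discrepancy-suc (at b) j) ⟨
  discrepancy (at a) (length a) ℤ.+ discrepancy (at b) (suc j) ∎
  where open ≡-Reasoning

discrepancy-complement : ∀ s {m} → m ≤ length s →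
  discrepancy (at (map not s)) m ≡ ℤ.- discrepancy (at s) m
discrepancy-complement s {zero}  _   =
  trans (discrepancy-zero (at (map not s))) (sym (cong ℤ.-_ (discrepancy-zero (at s))))
discrepancy-complement s {suc m} m<s = begin
  discrepancy (at (map not s)) (suc m)                     ≡⟨ discrepancy-suc (at (map not s)) m ⟩
  sign (at (map not s) m) ℤ.+ discrepancy (at (map not s)) m
    ≡⟨ cong₂ ℤ._+_ (cong sign (at-map-not s m<s)) (discrepancy-complement s (ℕ.<⇒≤ m<s)) ⟩
  sign (not (at s m)) ℤ.+ ℤ.- discrepancy (at s) m
    ≡⟨ cong (ℤ._+ ℤ.- discrepancy (at s) m) (sign-not (at s m)) ⟩
  ℤ.- sign (at s m) ℤ.+ ℤ.- discrepancy (at s) m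
    ≡⟨ ℤ.neg-distrib-+ (sign (at s m)) (discrepancy (at s) m) ⟨
  ℤ.- (sign (at s m) ℤ.+ discrepancy (at s) m)             ≡⟨ cong ℤ.-_ (discrepancy-suc (at s) m) ⟨
  ℤ.- discrepancy (at s) (suc m)                           ∎
  where
  open ≡-Reasoning
  sign-not : ∀ b → sign (not b) ≡ ℤ.- sign b
  sign-not true  = refl
  sign-not false = refl

Balanced : Str → Set
Balanced s = discrepancy (at s) (length s) ≡ 0ℤ

Discrepancy≤ : ℕ → Str → Set
Discrepancy≤ L s = ∀ {m} → m ≤ length s → ℤ.∣ discrepancy (at s) m ∣ ≤ L

discrepancy≤length : ∀ s → Discrepancy≤ (length s) s
discrepancy≤length s {m} m≤s = ℕ.≤-trans (∣discrepancy∣≤ (at s) m) m≤s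

∣discrepancy∣≤-agreeing : ∀ {f L m} S → m ≤ length S → Discrepancy≤ L S →
  (∀ {k} → k < m → f k ≡ at S k) → ℤ.∣ discrepancy f m ∣ ≤ L
∣discrepancy∣≤-agreeing {f} {L} {m} S m≤S bnd f≡S =
  subst (λ d → ℤ.∣ d ∣ ≤ L) (sym (discrepancy-cong m f≡S)) (bnd m≤S)

balanced-++ : ∀ a b → Balanced a → Balanced b → Balanced (a ++ b)
balanced-++ a b bal-a bal-b = begin
  discrepancy (at (a ++ b)) (length (a ++ b))
    ≡⟨ cong (discrepancy (at (a ++ b))) (List.length-++ a) ⟩
  discrepancy (at (a ++ b)) (length a + length b)
    ≡⟨ discrepancy-++ a b (length b) ⟩
  discrepancy (at a) (length a) ℤ.+ discrepancy (at b) (length b)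
    ≡⟨ cong₂ ℤ._+_ bal-a bal-b ⟩
  0ℤ ∎
  where open ≡-Reasoning

discrepancy≤-++ : ∀ {L} a b → Balanced a → Discrepancy≤ L a → Discrepancy≤ L b →
  Discrepancy≤ L (a ++ b)
discrepancy≤-++ {L} a b bal-a bnd-a bnd-b {m} m≤ab with m ≤? length a
... | yes m≤a = subst (λ d → ℤ.∣ d ∣ ≤ L) (sym (discrepancy-++ˡ a b m≤a)) (bnd-a m≤a)
... | no  m≰a = subst (λ k → ℤ.∣ discrepancy (at (a ++ b)) k ∣ ≤ L) a+j≡m beyond
  where
  j = m ℕ.∸ length a
  a+j≡m : length a + j ≡ m
  a+j≡m = ℕ.m+[n∸m]≡n (ℕ.<⇒≤ (ℕ.≰⇒> m≰a))
  j≤b : j ≤ length b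
  j≤b = ℕ.+-cancelˡ-≤ (length a) j (length b) (subst₂ _≤_ (sym a+j≡m) (List.length-++ a) m≤ab)
  beyond : ℤ.∣ discrepancy (at (a ++ b)) (length a + j) ∣ ≤ L
  beyond = begin
    ℤ.∣ discrepancy (at (a ++ b)) (length a + j) ∣
      ≡⟨ cong ℤ.∣_∣ (discrepancy-++ a b j) ⟩
    ℤ.∣ discrepancy (at a) (length a) ℤ.+ discrepancy (at b) j ∣
      ≡⟨ cong (λ d → ℤ.∣ d ℤ.+ discrepancy (at b) j ∣) bal-a ⟩
    ℤ.∣ 0ℤ ℤ.+ discrepancy (at b) j ∣
      ≡⟨ cong ℤ.∣_∣ (ℤ.+-identityˡ (discrepancy (at b) j)) ⟩
    ℤ.∣ discrepancy (at b) j ∣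
      ≤⟨ bnd-b j≤b ⟩
    L ∎
    where open ℕ.≤-Reasoning

balanced-map-xor : ∀ b s → Balanced s → Balanced (map (b xor_) s)
balanced-map-xor false s bal = subst Balanced (sym (List.map-id s)) bal
balanced-map-xor true  s bal
  rewrite List.length-map not s | discrepancy-complement s {length s} ℕ.≤-refl | bal = refl

discrepancy≤-map-xor : ∀ b {L} s → Discrepancy≤ L s → Discrepancy≤ L (map (b xor_) s)
discrepancy≤-map-xor false {L} s bnd = subst (Discrepancy≤ L) (sym (List.map-id s)) bnd
discrepancy≤-map-xor true  {L} s bnd {m} m≤ = begin
  ℤ.∣ discrepancy (at (map not s)) m ∣   ≡⟨ cong ℤ.∣_∣ (discrepancy-complement s m≤s) ⟩
  ℤ.∣ ℤ.- discrepancy (at s) m ∣         ≡⟨ ℤ.∣-i∣≡∣i∣ (discrepancy (at s) m) ⟩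
  ℤ.∣ discrepancy (at s) m ∣             ≤⟨ bnd m≤s ⟩
  L                                       ∎
  where
  open ℕ.≤-Reasoning
  m≤s : m ≤ length s
  m≤s = subst (m ≤_) (List.length-map not s) m≤

-- Growing strings

extend : Str → Bool → Str
extend s b = s ++ map (b xor_) s

grow : Str → Str → Str
grow = foldl extend

length-extend : ∀ s b → length (extend s b) ≡ length s + length s
length-extend s b = trans (List.length-++ s) (cong (_+_ (length s)) (List.length-map (b xor_) s))

balanced-extend : ∀ s b → Balanced s → Balanced (extend s b)
balanced-extend s b bal = balanced-++ s (map (b xor_) s) bal (balanced-map-xor b s bal)

discrepancy≤-extend : ∀ {L} s b → Balanced s → Discrepancy≤ L s → Discrepancy≤ L (extend s b)
discrepancy≤-extend s b bal bnd =
  discrepancy≤-++ s (map (b xor_) s) bal bnd (discrepancy≤-map-xor b s bnd)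

balanced-extend-true : ∀ s → Balanced (extend s true)
balanced-extend-true s = begin
  discrepancy (at (s ++ map not s)) (length (s ++ map not s))
    ≡⟨ cong (discrepancy (at (s ++ map not s))) (length-extend s true) ⟩
  discrepancy (at (s ++ map not s)) (length s + length s)
    ≡⟨ discrepancy-++ s (map not s) (length s) ⟩
  discrepancy (at s) (length s) ℤ.+ discrepancy (at (map not s)) (length s)
    ≡⟨ cong (ℤ._+_ (discrepancy (at s) (length s))) (discrepancy-complement s {length s} ℕ.≤-refl) ⟩
  discrepancy (at s) (length s) ℤ.+ ℤ.- discrepancy (at s) (length s)
    ≡⟨ ℤ.+-inverseʳ (discrepancy (at s) (length s)) ⟩
  0ℤ ∎
  where open ≡-Reasoning

discrepancy≤-grow : ∀ {L} s ρ → Balanced s → Discrepancy≤ L s → Discrepancy≤ L (grow s ρ)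
discrepancy≤-grow s []      bal bnd = bnd
discrepancy≤-grow s (b ∷ ρ) bal bnd =
  discrepancy≤-grow (extend s b) ρ (balanced-extend s b bal) (discrepancy≤-extend s b bal bnd)

length-grow : ∀ s ρ → 0 < length s → length s + length ρ ≤ length (grow s ρ)
length-grow s []      _   = ℕ.≤-reflexive (ℕ.+-identityʳ (length s))
length-grow s (b ∷ ρ) 0<s = begin
  length s + suc (length ρ)        ≡⟨ ℕ.+-suc (length s) (length ρ) ⟩
  suc (length s) + length ρ        ≤⟨ ℕ.+-monoˡ-≤ (length ρ) (ℕ.+-monoˡ-≤ (length s) 0<s) ⟩
  (length s + length s) + length ρ ≡⟨ cong (_+ length ρ) (length-extend s b) ⟨
  length (extend s b) + length ρ   ≤⟨ length-grow (extend s b) ρ 0<extend ⟩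
  length (grow (extend s b) ρ)     ∎
  where
  open ℕ.≤-Reasoning
  0<extend : 0 < length (extend s b)
  0<extend = subst (0 <_) (sym (length-extend s b)) (ℕ.<-≤-trans 0<s (ℕ.m≤m+n (length s) (length s)))

≼-grow : ∀ s ρ → s ≼ grow s ρ
≼-grow s []      = Prefix.fromPointwise (Pointwise.refl refl)
≼-grow s (b ∷ ρ) = Prefix.trans trans (≼-++ s (map (b xor_) s)) (≼-grow (extend s b) ρ)

grow-mono : ∀ s {σ τ} → σ ≼ τ → grow s σ ≼ grow s τ
grow-mono s {τ = τ} []  = ≼-grow s τ
grow-mono s {b ∷ _} (refl ∷ p) = grow-mono (extend s b) p

extend-incompatible : ∀ s → 0 < length s → Incompatible (extend s false) (extend s true)
extend-incompatible (x ∷ s) _ = incompatible-++ (x ∷ s)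
  ((λ { (x≡¬x ∷ _) → not-¬ refl x≡¬x }) , (λ { (¬x≡x ∷ _) → not-¬ refl (sym ¬x≡x) }))

≺-extend : ∀ s b → 0 < length s → s ≺ extend s b
≺-extend s b 0<s = ≺-++ s (subst (0 <_) (sym (List.length-map (b xor_) s)) 0<s)

0<length-grow : ∀ s ρ → 0 < length s → 0 < length (grow s ρ)
0<length-grow s ρ 0<s =
  ℕ.<-≤-trans (ℕ.<-≤-trans 0<s (ℕ.m≤m+n (length s) (length ρ))) (length-grow s ρ 0<s)

grow-perfect : ∀ s → 0 < length s → IsPerfectTree (grow s)
grow-perfect s 0<s σ rewrite List.foldl-++ extend s σ [ false ] | List.foldl-++ extend s σ [ true ] =
  extend-incompatible (grow s σ) 0<t , ≺-extend (grow s σ) false 0<t , ≺-extend (grow s σ) true 0<t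
  where
  0<t : 0 < length (grow s σ)
  0<t = 0<length-grow s σ 0<s

discrepancy≤-grow-≼ : ∀ {L} s {σ τ} → σ ≼ τ →
  Balanced (grow s σ) → Discrepancy≤ L (grow s σ) → Discrepancy≤ L (grow s τ)
discrepancy≤-grow-≼ s {τ = τ} []         bal bnd = discrepancy≤-grow s τ bal bnd
discrepancy≤-grow-≼ s {b ∷ _} (refl ∷ p) bal bnd = discrepancy≤-grow-≼ (extend s b) p bal bnd

discrepancy≤-grow-after-true : ∀ s σ {τ} → (σ ∷ʳ true) ≼ τ →
  Discrepancy≤ (length (grow s (σ ∷ʳ true))) (grow s τ)
discrepancy≤-grow-after-true s σ σ1≼τ =
  discrepancy≤-grow-≼ s σ1≼τ balanced (discrepancy≤length (grow s (σ ∷ʳ true)))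
  where
  balanced : Balanced (grow s (σ ∷ʳ true))
  balanced = subst Balanced (sym (List.foldl-∷ʳ extend s true σ)) (balanced-extend-true (grow s σ))

-- Paths

applyUpTo-≼ : ∀ (f : ℕ → Bool) {m n} → m ≤ n → applyUpTo f m ≼ applyUpTo f n
applyUpTo-≼ f z≤n       = []
applyUpTo-≼ f (s≤s m≤n) = refl ∷ applyUpTo-≼ (f ∘ suc) m≤n

↾-≼ : ∀ X {m n} → m ≤ n → (X ↾ m) ≼ (X ↾ n)
↾-≼ X {m} {n} m≤n = subst₂ _≼_ (sym (List.map-upTo X m)) (sym (List.map-upTo X n)) (applyUpTo-≼ X m≤n)

↾-suc : ∀ X n → X ↾ suc n ≡ (X ↾ n) ∷ʳ X n
↾-suc X n = begin
  X ↾ suc n              ≡⟨ List.map-upTo X (suc n) ⟩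
  applyUpTo X (suc n)    ≡⟨ List.applyUpTo-∷ʳ X n ⟨
  applyUpTo X n ∷ʳ X n   ≡⟨ cong (_∷ʳ X n) (List.map-upTo X n) ⟨
  (X ↾ n) ∷ʳ X n         ∎
  where open ≡-Reasoning

length-↾ : ∀ X n → length (X ↾ n) ≡ n
length-↾ X n = trans (List.length-map X (upTo n)) (List.length-upTo n)

length-grow-↾ : ∀ s → 0 < length s → ∀ X n → n < length (grow s (X ↾ n))
length-grow-↾ s 0<s X n = begin-strict
  n                           <⟨ ℕ.m<n+m n 0<s ⟩
  length s + n                ≡⟨ cong (_+_ (length s)) (length-↾ X n) ⟨
  length s + length (X ↾ n)   ≤⟨ length-grow s (X ↾ n) 0<s ⟩
  length (grow s (X ↾ n))     ∎
  where open ℕ.≤-Reasoning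

path-at : ∀ s → 0 < length s → ∀ X {k M} → k < M → path (grow s) X k ≡ at (grow s (X ↾ M)) k
path-at s 0<s X {k} k<M =
  sym (at-≼ (grow-mono s (↾-≼ X k<M)) (ℕ.<-trans (ℕ.n<1+n k) (length-grow-↾ s 0<s X (suc k))))

path-density½ : ∀ s → 0 < length s → Balanced s → ∀ X → HasDensity (path (grow s) X) ½
path-density½ s 0<s bal X = bounded-discrepancy⇒density½ (path (grow s) X) (length s) λ m →
  ∣discrepancy∣≤-agreeing (grow s (X ↾ m)) (ℕ.<⇒≤ (length-grow-↾ s 0<s X m))
    (discrepancy≤-grow s (X ↾ m) bal (discrepancy≤length s)) (path-at s 0<s X)

-- Symmetric differences of paths

zipWith-++ : ∀ {A B C : Set} (f : A → B → C) a b c d → length a ≡ length b →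
  zipWith f (a ++ c) (b ++ d) ≡ zipWith f a b ++ zipWith f c d
zipWith-++ f []      []      c d _   = refl
zipWith-++ f (x ∷ a) (y ∷ b) c d a≡b = cong (f x y ∷_) (zipWith-++ f a b c d (ℕ.suc-injective a≡b))

zipWith-map-diagonal : ∀ {A B C I : Set} (f : A → B → C) (g : I → A) (h : I → B) l →
  zipWith f (map g l) (map h l) ≡ map (λ i → f (g i) (h i)) l
zipWith-map-diagonal f g h []      = refl
zipWith-map-diagonal f g h (i ∷ l) = cong (f (g i) (h i) ∷_) (zipWith-map-diagonal f g h l)

at-zipWith : ∀ (f : Bool → Bool → Bool) a b {k} → k < length a → k < length b →
  at (zipWith f a b) k ≡ f (at a k) (at b k)
at-zipWith f (x ∷ a) (y ∷ b) {zero}  _         _         = refl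
at-zipWith f (x ∷ a) (y ∷ b) {suc k} (s≤s k<a) (s≤s k<b) = at-zipWith f a b k<a k<b

zipWith-xor-map : ∀ x y a b →
  zipWith _xor_ (map (x xor_) a) (map (y xor_) b) ≡ map ((x xor y) xor_) (zipWith _xor_ a b)
zipWith-xor-map x y a b = begin
  zipWith _xor_ (map (x xor_) a) (map (y xor_) b)
    ≡⟨ List.zipWith-map _xor_ (x xor_) (y xor_) a b ⟩
  zipWith (λ u v → (x xor u) xor (y xor v)) a b
    ≡⟨ List.zipWith-cong (λ u v → Xor.interchange x u y v) a b ⟩
  zipWith (λ u v → (x xor y) xor (u xor v)) a b
    ≡⟨ List.map-zipWith _xor_ ((x xor y) xor_) a b ⟨
  map ((x xor y) xor_) (zipWith _xor_ a b) ∎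
  where open ≡-Reasoning

zipWith-xor-extend : ∀ a b x y → length a ≡ length b →
  zipWith _xor_ (extend a x) (extend b y) ≡ extend (zipWith _xor_ a b) (x xor y)
zipWith-xor-extend a b x y a≡b =
  trans (zipWith-++ _xor_ a b (map (x xor_) a) (map (y xor_) b) a≡b)
        (cong (zipWith _xor_ a b ++_) (zipWith-xor-map x y a b))

zipWith-xor-grow : ∀ a b σ τ → length a ≡ length b → length σ ≡ length τ →
  zipWith _xor_ (grow a σ) (grow b τ) ≡ grow (zipWith _xor_ a b) (zipWith _xor_ σ τ)
zipWith-xor-grow a b []      []      _   _   = refl
zipWith-xor-grow a b (x ∷ σ) (y ∷ τ) a≡b σ≡τ = begin
  zipWith _xor_ (grow (extend a x) σ) (grow (extend b y) τ)
    ≡⟨ zipWith-xor-grow (extend a x) (extend b y) σ τ (length-extend-cong a≡b) (ℕ.suc-injective σ≡τ) ⟩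
  grow (zipWith _xor_ (extend a x) (extend b y)) (zipWith _xor_ σ τ)
    ≡⟨ cong (λ c → grow c (zipWith _xor_ σ τ)) (zipWith-xor-extend a b x y a≡b) ⟩
  grow (extend (zipWith _xor_ a b) (x xor y)) (zipWith _xor_ σ τ) ∎
  where
  open ≡-Reasoning
  length-extend-cong : length a ≡ length b → length (extend a x) ≡ length (extend b y)
  length-extend-cong a≡b =
    trans (length-extend a x) (trans (cong₂ _+_ a≡b a≡b) (sym (length-extend b y)))

xor-≢ : ∀ {x y} → x ≢ y → x xor y ≡ true
xor-≢ {false} {false} x≢y = ⊥-elim (x≢y refl)
xor-≢ {false} {true}  _   = refl
xor-≢ {true}  {false} _   = refl
xor-≢ {true}  {true}  x≢y = ⊥-elim (x≢y refl)

path-△ : ∀ s → 0 < length s → ∀ X Y {k M} → k < M →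
  (path (grow s) X △ path (grow s) Y) k ≡ at (grow (zipWith _xor_ s s) ((X △ Y) ↾ M)) k
path-△ s 0<s X Y {k} {M} k<M = begin
  path (grow s) X k xor path (grow s) Y k
    ≡⟨ cong₂ _xor_ (path-at s 0<s X k<M) (path-at s 0<s Y k<M) ⟩
  at (grow s (X ↾ M)) k xor at (grow s (Y ↾ M)) k
    ≡⟨ at-zipWith _xor_ (grow s (X ↾ M)) (grow s (Y ↾ M)) (k<grow X) (k<grow Y) ⟨
  at (zipWith _xor_ (grow s (X ↾ M)) (grow s (Y ↾ M))) k
    ≡⟨ cong (λ t → at t k) (zipWith-xor-grow s s (X ↾ M) (Y ↾ M) refl |X↾M|≡|Y↾M|) ⟩
  at (grow (zipWith _xor_ s s) (zipWith _xor_ (X ↾ M) (Y ↾ M))) k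
    ≡⟨ cong (λ σ → at (grow (zipWith _xor_ s s) σ) k) (zipWith-map-diagonal _xor_ X Y (upTo M)) ⟩
  at (grow (zipWith _xor_ s s) ((X △ Y) ↾ M)) k ∎
  where
  open ≡-Reasoning
  |X↾M|≡|Y↾M| : length (X ↾ M) ≡ length (Y ↾ M)
  |X↾M|≡|Y↾M| = trans (length-↾ X M) (sym (length-↾ Y M))
  k<grow : ∀ Z → k < length (grow s (Z ↾ M))
  k<grow Z = ℕ.<-trans k<M (length-grow-↾ s 0<s Z M)

△-density½ : ∀ s → 0 < length s → ∀ X Y → Distinct X Y →
  HasDensity (path (grow s) X △ path (grow s) Y) ½
△-density½ s 0<s X Y (j , Xj≢Yj) =
  bounded-discrepancy⇒density½ (path (grow s) X △ path (grow s) Y) L λ m →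
    ∣discrepancy∣≤-agreeing (grow z (Z ↾ (suc j + m)))
      (ℕ.<⇒≤ (ℕ.≤-<-trans (ℕ.m≤n+m m (suc j)) (length-grow-↾ z 0<z Z (suc j + m))))
      (discrepancy≤-grow-after-true z (Z ↾ j) (prefix m))
      (λ k<m → path-△ s 0<s X Y (ℕ.<-≤-trans k<m (ℕ.m≤n+m m (suc j))))
  where
  Z = X △ Y
  z = zipWith _xor_ s s
  L = length (grow z ((Z ↾ j) ∷ʳ true))
  0<z : 0 < length z
  0<z = subst (0 <_) (sym (trans (List.length-zipWith _xor_ s s) (ℕ.⊓-idem (length s)))) 0<s
  prefix : ∀ m → ((Z ↾ j) ∷ʳ true) ≼ (Z ↾ (suc j + m))
  prefix m = subst (_≼ (Z ↾ (suc j + m))) (trans (↾-suc Z j) (cong ((Z ↾ j) ∷ʳ_) (xor-≢ Xj≢Yj)))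
                   (↾-≼ Z (ℕ.m≤m+n (suc j) m))

seed : Str
seed = false ∷ true ∷ []

seed-balanced : Balanced seed
seed-balanced = balanced-extend-true [ false ]

tree : Str → Str
tree = grow seed

theorem7p13 : Σ (Str → Str) λ T → IsPerfectTree T
    × (∀ (X : Seq) → HasDensity (path T X) ½)
    × (∀ (X Y : Seq) → Distinct X Y → HasDensity (path T X △ path T Y) ½)
theorem7p13 =
  tree , grow-perfect seed 0<2 , path-density½ seed 0<2 seed-balanced , △-density½ seed 0<2
  where
  0<2 : 0 < length seed
  0<2 = s≤s z≤n
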